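{- For moded propositions define the pure proposition $c(P)$ by $c(A^\oplus)=A$, $c(A^\ominus)=\neg A$, $c(A^+)=A$, $c(A^-)=\neg A$. If the sequent $P_1,\dots,P_n\vdash Q$ holds in $\textsc{prk}$, then the sequent $c(P_1),\dots,c(P_n)\vdash c(Q)$ holds in classical propositional logic.
   Context: **Propositions.** Fix a denumerable set of propositional variables $\alpha,\beta,\dots$. Pure propositions: $A,B ::= \alpha \mid A\land B\mid A\lor B\mid \neg A$. (Moded) propositions: $P,Q ::= A^+\mid A^-\mid A^\oplus\mid A^\ominus$ with $A$ pure; $A^+,A^-$ are strong, $A^\oplus,A^\ominus$ are classical. The opposite $P^\sim$ is: $(A^+)^\sim=A^-$, $(A^-)^\sim=A^+$, $(A^\oplus)^\sim=A^\ominus$, $(A^\ominus)^\sim=A^\oplus$. **System $\textsc{prk}$.** Judgments $\Gamma\vdash P$ with $\Gamma$ a finite set of propositions ($\Gamma,P$ means $\Gamma\cup\{P\}$), derivable by the rules (for $i\in\{1,2\}$): - (Ax) $\Gamma,P\vdash P$. (Abs) From $\Gamma\vdash P$ and $\Gamma\vdash P^\sim$ with $P$ strong, infer $\Gamma\vdash Q$ (any $Q$). - (I$\land^+$) From $\Gamma\vdash A^\oplus$ and $\Gamma\vdash B^\oplus$ infer $\Gamma\vdash(A\land B)^+$. (I$\lor^-$) From $\Gamma\vdash A^\ominus$ and $\Gamma\vdash B^\ominus$ infer $\Gamma\vdash(A\lor B)^-$. - (E$\land^+_i$) From $\Gamma\vdash(A_1\land A_2)^+$ infer $\Gamma\vdash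 A_i^\oplus$. (E$\lor^-_i$) From $\Gamma\vdash(A_1\lor A_2)^-$ infer $\Gamma\vdash A_i^\ominus$. - (I$\lor^+_i$) From $\Gamma\vdash A_i^\oplus$ infer $\Gamma\vdash(A_1\lor A_2)^+$. (I$\land^-_i$) From $\Gamma\vdash A_i^\ominus$ infer $\Gamma\vdash(A_1\land A_2)^-$. - (E$\lor^+$) From $\Gamma\vdash(A\lor B)^+$, $\Gamma,A^\oplus\vdash P$ and $\Gamma,B^\oplus\vdash P$ infer $\Gamma\vdash P$. (E$\land^-$) From $\Gamma\vdash(A\land B)^-$, $\Gamma,A^\ominus\vdash P$ and $\Gamma,B^\ominus\vdash P$ infer $\Gamma\vdash P$. - (I$\neg^+$) From $\Gamma\vdash A^\ominus$ infer $\Gamma\vdash(\neg A)^+$. (I$\neg^-$) From $\Gamma\vdash A^\oplus$ infer $\Gamma\vdash(\neg A)^-$. (E$\neg^+$) From $\Gamma\vdash(\neg A)^+$ infer $\Gamma\vdash A^\ominus$. (E$\neg^-$) From $\Gamma\vdash(\neg A)^-$ infer $\Gamma\vdash A^\oplus$. - (IC$^+$) From $\Gamma,A^\ominus\vdash A^+$ infer $\Gamma\vdash A^\oplus$. (IC$^-$) From $\Gamma,A^\oplus\vdash A^-$ infer $\Gamma\vdash A^\ominus$. - (EC$^+$) From $\Gamma\vdash A^\oplus$ and $\Gamma\vdash A^\ominus$ infer $\Gamma\vdash A^+$. (EC$^-$) From $\Gamma\vdash A^\ominus$ and $\Gamma\vdash A^\oplus$ infer $\Gamma\vdash A^-$.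 -}

module Defs where

open import Data.Nat.Base using (ℕ)
open import Data.List.Base using (List; _∷_)
open import Data.List.Membership.Propositional using (_∈_)

infix  9 ¬_
infixr 7 _∧_
infixr 6 _∨_
infix  5 _⁺ _⁻ _⊕ _⊖
infix  5 _~
infixl 3 _,_
infix  2 _⊢_ _⊢ᶜ_

data Pure : Set where
  var : ℕ → Pure
  _∧_ : Pure → Pure → Pure
  _∨_ : Pure → Pure → Pure
  ¬_  : Pure → Pure

data Moded : Set where
  _⁺ _⁻ _⊕ _⊖ : Pure → Moded

data Strong : Moded → Set where
  strong⁺ : (A : Pure) → Strong (A ⁺)
  strong⁻ : (A : Pure) → Strong (A ⁻)

_~ : Moded → Moded
(A ⁺) ~ = A ⁻
(A ⁻) ~ = A ⁺
(A ⊕) ~ = A ⊖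
(A ⊖) ~ = A ⊕

-- A context is a finite set, given by a list of its elements.  Since the axiom
-- rules consult a context only through membership, order and multiplicity are
-- immaterial to derivability, and _,_ represents the union Γ ∪ {P}.

_,_ : {X : Set} → List X → X → List X
Γ , x = x ∷ Γ

variable
  Γ         : List Moded
  P Q       : Moded
  Δ         : List Pure
  A B C     : Pure

data _⊢_ : List Moded → Moded → Set where

  Ax   : P ∈ Γ → Γ ⊢ P
  Abs  : Strong P → Γ ⊢ P → Γ ⊢ P ~ → Γ ⊢ Q

  I∧⁺  : Γ ⊢ A ⊕ → Γ ⊢ B ⊕ → Γ ⊢ (A ∧ B) ⁺
  I∨⁻  : Γ ⊢ A ⊖ → Γ ⊢ B ⊖ → Γ ⊢ (A ∨ B) ⁻

  E∧⁺₁ : Γ ⊢ (A ∧ B) ⁺ → Γ ⊢ A ⊕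
  E∧⁺₂ : Γ ⊢ (A ∧ B) ⁺ → Γ ⊢ B ⊕
  E∨⁻₁ : Γ ⊢ (A ∨ B) ⁻ → Γ ⊢ A ⊖
  E∨⁻₂ : Γ ⊢ (A ∨ B) ⁻ → Γ ⊢ B ⊖

  I∨⁺₁ : Γ ⊢ A ⊕ → Γ ⊢ (A ∨ B) ⁺
  I∨⁺₂ : Γ ⊢ B ⊕ → Γ ⊢ (A ∨ B) ⁺
  I∧⁻₁ : Γ ⊢ A ⊖ → Γ ⊢ (A ∧ B) ⁻
  I∧⁻₂ : Γ ⊢ B ⊖ → Γ ⊢ (A ∧ B) ⁻

  E∨⁺  : Γ ⊢ (A ∨ B) ⁺ → Γ , A ⊕ ⊢ P → Γ , B ⊕ ⊢ P → Γ ⊢ P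
  E∧⁻  : Γ ⊢ (A ∧ B) ⁻ → Γ , A ⊖ ⊢ P → Γ , B ⊖ ⊢ P → Γ ⊢ P

  I¬⁺  : Γ ⊢ A ⊖ → Γ ⊢ (¬ A) ⁺
  I¬⁻  : Γ ⊢ A ⊕ → Γ ⊢ (¬ A) ⁻
  E¬⁺  : Γ ⊢ (¬ A) ⁺ → Γ ⊢ A ⊖
  E¬⁻  : Γ ⊢ (¬ A) ⁻ → Γ ⊢ A ⊕

  IC⁺  : Γ , A ⊖ ⊢ A ⁺ → Γ ⊢ A ⊕
  IC⁻  : Γ , A ⊕ ⊢ A ⁻ → Γ ⊢ A ⊖
  EC⁺  : Γ ⊢ A ⊕ → Γ ⊢ A ⊖ → Γ ⊢ A ⁺
  EC⁻  : Γ ⊢ A ⊖ → Γ ⊢ A ⊕ → Γ ⊢ A ⁻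

-- Classical propositional logic: Gentzen's natural deduction with excluded
-- middle.  The language has no ⊥, so a contradiction in the negation rules is expressed
-- by deriving a proposition together with its negation.

data _⊢ᶜ_ : List Pure → Pure → Set where

  ax  : A ∈ Δ → Δ ⊢ᶜ A

  I∧  : Δ ⊢ᶜ A → Δ ⊢ᶜ B → Δ ⊢ᶜ A ∧ B
  E∧₁ : Δ ⊢ᶜ A ∧ B → Δ ⊢ᶜ A
  E∧₂ : Δ ⊢ᶜ A ∧ B → Δ ⊢ᶜ B

  I∨₁ : Δ ⊢ᶜ A → Δ ⊢ᶜ A ∨ B
  I∨₂ : Δ ⊢ᶜ B → Δ ⊢ᶜ A ∨ B
  E∨  : Δ ⊢ᶜ A ∨ B → Δ , A ⊢ᶜ C → Δ , B ⊢ᶜ C → Δ ⊢ᶜ C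

  I¬  : Δ , A ⊢ᶜ B → Δ , A ⊢ᶜ ¬ B → Δ ⊢ᶜ ¬ A
  E¬  : Δ ⊢ᶜ A → Δ ⊢ᶜ ¬ A → Δ ⊢ᶜ B

  LEM : Δ ⊢ᶜ A ∨ ¬ A

c : Moded → Pure
c (A ⊕) = A
c (A ⊖) = ¬ A
c (A ⁺) = A
c (A ⁻) = ¬ A

{-# OPTIONS --safe #-}
module Submission where

open import Defs
open import Data.List.Base using (List; map)
open import Data.List.Membership.Propositional.Properties using (∈-map⁺)
open import Data.List.Relation.Binary.Subset.Propositional using (_⊆_)
open import Data.List.Relation.Binary.Subset.Propositional.Properties using (∷⁺ʳ; xs⊆x∷xs)
open import Data.List.Relation.Unary.Any using (here; there)
open import Relation.Binary.PropositionalEquality using (refl)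

-- Under `c` the strong and classical modes collapse and the sign becomes presence or absence of
-- `¬_`. Each rule of the moded system thus turns into a classically admissible rule, and induction
-- on the derivation concludes. The negative rules for `_∧_` and `_∨_` become De Morgan laws.
-- Excluded middle enters for just three rules: `IC⁺`, `E¬⁻` and `E∧⁻`.

weaken : {Δ′ : List Pure} → Δ ⊆ Δ′ → Δ ⊢ᶜ A → Δ′ ⊢ᶜ A
weaken s (ax i)     = ax (s i)
weaken s (I∧ d e)   = I∧ (weaken s d) (weaken s e)
weaken s (E∧₁ d)    = E∧₁ (weaken s d)
weaken s (E∧₂ d)    = E∧₂ (weaken s d)
weaken s (I∨₁ d)    = I∨₁ (weaken s d)
weaken s (I∨₂ d)    = I∨₂ (weaken s d)
weaken s (E∨ d e f) = E∨ (weaken s d) (weaken (∷⁺ʳ _ s) e) (weaken (∷⁺ʳ _ s) f)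
weaken s (I¬ d e)   = I¬ (weaken (∷⁺ʳ _ s) d) (weaken (∷⁺ʳ _ s) e)
weaken s (E¬ d e)   = E¬ (weaken s d) (weaken s e)
weaken s LEM        = LEM

weaken₁ : Δ ⊢ᶜ A → Δ , B ⊢ᶜ A
weaken₁ = weaken (xs⊆x∷xs _ _)

hyp₀ : Δ , A ⊢ᶜ A
hyp₀ = ax (here refl)

hyp₁ : Δ , A , B ⊢ᶜ A
hyp₁ = ax (there (here refl))

contrapose : Δ , B ⊢ᶜ A → Δ ⊢ᶜ ¬ A → Δ ⊢ᶜ ¬ B
contrapose d e = I¬ d (weaken₁ e)

-- The image of `IC⁺` under `c`, by cases on `A`.
consequentia-mirabilis : Δ , ¬ A ⊢ᶜ A → Δ ⊢ᶜ A
consequentia-mirabilis d = E∨ LEM hyp₀ d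

¬¬-intro : Δ ⊢ᶜ A → Δ ⊢ᶜ ¬ ¬ A
¬¬-intro d = I¬ (weaken₁ d) hyp₀

¬¬-elim : Δ ⊢ᶜ ¬ ¬ A → Δ ⊢ᶜ A
¬¬-elim d = consequentia-mirabilis (E¬ hyp₀ (weaken₁ d))

¬∨-intro : Δ ⊢ᶜ ¬ A → Δ ⊢ᶜ ¬ B → Δ ⊢ᶜ ¬ (A ∨ B)
-- Under `A ∨ B`, refuting `B` leaves `A`, which contradicts `¬ A`.
¬∨-intro d e = contrapose (E∨ hyp₀ hyp₀ (E¬ hyp₀ (weaken₁ (weaken₁ e)))) d

-- The De Morgan law that fails intuitionistically; deciding `A` determines which disjunct to prove.
¬∧⇒∨¬ : Δ ⊢ᶜ ¬ (A ∧ B) → Δ ⊢ᶜ ¬ A ∨ ¬ B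
¬∧⇒∨¬ d = E∨ LEM (I∨₂ (contrapose (I∧ hyp₁ hyp₀) (weaken₁ d))) (I∨₁ hyp₀)

-- `map c (Γ , P)` computes to `map c Γ , c P`, so premises with an extra hypothesis translate
-- directly.
c-sound : Γ ⊢ P → map c Γ ⊢ᶜ c P
c-sound (Ax i)                 = ax (∈-map⁺ c i)
c-sound (Abs (strong⁺ _) d e)  = E¬ (c-sound d) (c-sound e)
-- Here the opposite is the positive proposition, so the premises swap.
c-sound (Abs (strong⁻ _) d e)  = E¬ (c-sound e) (c-sound d)
c-sound (I∧⁺ d e)              = I∧ (c-sound d) (c-sound e)
c-sound (I∨⁻ d e)              = ¬∨-intro (c-sound d) (c-sound e)
c-sound (E∧⁺₁ d)               = E∧₁ (c-sound d)
c-sound (E∧⁺₂ d)               = E∧₂ (c-sound d)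
c-sound (E∨⁻₁ d)               = contrapose (I∨₁ hyp₀) (c-sound d)
c-sound (E∨⁻₂ d)               = contrapose (I∨₂ hyp₀) (c-sound d)
c-sound (I∨⁺₁ d)               = I∨₁ (c-sound d)
c-sound (I∨⁺₂ d)               = I∨₂ (c-sound d)
c-sound (I∧⁻₁ d)               = contrapose (E∧₁ hyp₀) (c-sound d)
c-sound (I∧⁻₂ d)               = contrapose (E∧₂ hyp₀) (c-sound d)
c-sound (E∨⁺ d e f)            = E∨ (c-sound d) (c-sound e) (c-sound f)
c-sound (E∧⁻ d e f)            = E∨ (¬∧⇒∨¬ (c-sound d)) (c-sound e) (c-sound f)
c-sound (I¬⁺ d)                = c-sound d
c-sound (I¬⁻ d)                = ¬¬-intro (c-sound d)
c-sound (E¬⁺ d)                = c-sound d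
c-sound (E¬⁻ d)                = ¬¬-elim (c-sound d)
c-sound (IC⁺ d)                = consequentia-mirabilis (c-sound d)
-- Assuming `A` gives both `A` itself and `¬ A`; this dual of `IC⁺` is constructive.
c-sound (IC⁻ d)                = I¬ hyp₀ (c-sound d)
-- The first premise and the conclusion have the same image under `c`.
c-sound (EC⁺ d e)              = c-sound d
c-sound (EC⁻ d e)              = c-sound d

proposition38 : (Ps : List Moded) (R : Moded) → Ps ⊢ R → map c Ps ⊢ᶜ c R
proposition38 _ _ = c-sound
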